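{- Let $m\ge 2$ be an integer. For every $r\geq r^*_m$ there is an $r$-robust strategy for searching in the $m$-ray star with positional prediction that has consistency at most $$1+\frac{2}{b_r-1}.$$
   Context: The $m$-ray star consists of $m$ unbounded rays, indexed $0,\ldots,m-1$, with a common endpoint $O$ (the origin). A search strategy is an infinite sequence $X=(x_i,u_i)_{i}$ with $x_i\in\mathbb{R}^+$ and $u_i\in\{0,\ldots,m-1\}$: in iteration $i$ a unit-speed searcher starts from $O$, walks on ray $u_i$ up to distance $x_i$ from $O$, returns to $O$, and continues with iteration $i+1$, until the target is located. For a target $t$, $d(t)$ is its distance from $O$, and $d(X,t)$ is the total distance walked until the searcher first reaches $t$ ($\infty$ if never). Standing assumption: targets (and predicted positions) are at distance at least some fixed constant $d_0>0$ from $O$. In the positional prediction model the prediction is a position $h=(d_h,u_h)$ in the star, where $d_h$ is the predicted distance from $O$ and $u_h$ the predicted ray. A strategy with positional prediction specifies a search strategy $X_h$ for every $h$. Its consistency is its competitive ratio with error-free prediction, $\sup_h d(X_h,h)/d_h$. Its robustness is its competitive ratio with adversarial prediction, $\sup_{h,t} d(X_h,t)/d(t)$. It is $r$-robust if its robustness is at most $r$. Let $\rho^*_m=\frac{m^m}{(m-1)^{m-1}}$ and $r^*_m=1+2\rho^*_m$ (the optimal competitive ratio for $m$-ray search without prediction). For $r\ge r^*_m$, let $\rho_r=(r-1)/2$ and let $b_r$ be the largest real root of $\frac{x^m}{x-1}-\rho_r=0$ (equivalently, the largest $b>1$ for which the cyclic geometric strategy $(b^i, i \bmod m)_{i\ge0}$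 has competitive ratio $1+2b^m/(b-1)\le r$). -}

module Defs where

open import Level using (Level; _⊔_) renaming (suc to lsuc)
open import Algebra.Bundles using (CommutativeRing; Semiring)
import Algebra.Definitions.RawSemiring as RawSemiringDefinitions
open import Data.Fin.Base using (Fin; toℕ)
open import Data.Nat.Base as ℕ using (ℕ; _∸_)
open import Data.Product.Base using (∃; ∃-syntax; _×_)
open import Relation.Binary.Core using (Rel)
open import Relation.Binary.Structures using (IsDecTotalOrder)
import Relation.Binary.Construct.Add.Supremum.NonStrict as AddSupremum
import Relation.Binary.Construct.NonStrictToStrict as NonStrictToStrict
open import Relation.Binary.PropositionalEquality.Core using (_≡_)
open import Relation.Nullary.Construct.Add.Supremum using (_⁺; [_]; ⊤⁺)
open import Relation.Nullary.Negation.Core using (¬_)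
open import Relation.Unary using (Pred)

private
  variable
    a c ℓ ℓ₁ ℓ₂ p : Level

module _ {A : Set a} (_≤_ : Rel A ℓ) (P : Pred A p) where

  IsUpperBound : A → Set (a ⊔ ℓ ⊔ p)
  IsUpperBound u = ∀ x → P x → x ≤ u

  IsSupremum : A → Set (a ⊔ ℓ ⊔ p)
  IsSupremum s = IsUpperBound s × (∀ u → IsUpperBound u → s ≤ u)

  IsGreatest : A → Set (a ⊔ ℓ ⊔ p)
  IsGreatest x = P x × IsUpperBound x

-- The classical real numbers, axiomatised as the Dedekind-complete ordered
-- field. The order is decidable because the reals are read classically.
-- Classically `archimedean` follows from `complete`; it is a separate axiom
-- because the usual derivation does not produce the bound n constructively.

record RealField c ℓ₁ ℓ₂ : Set (lsuc (c ⊔ ℓ₁ ⊔ ℓ₂)) where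
  infix  4 _≤_
  infix  8 _⁻¹
  infixl 7 _/_

  field
    commutativeRing : CommutativeRing c ℓ₁

  open CommutativeRing commutativeRing public

  open RawSemiringDefinitions (Semiring.rawSemiring semiring) public
    using (_^_; sum)
    renaming (_×_ to _·_)

  fromℕ : ℕ → Carrier
  fromℕ n = n · 1#

  field
    _≤_             : Rel Carrier ℓ₂
    isDecTotalOrder : IsDecTotalOrder _≈_ _≤_
    +-monoˡ-≤       : ∀ z {x y} → x ≤ y → x + z ≤ y + z
    *-nonNegative   : ∀ {x y} → 0# ≤ x → 0# ≤ y → 0# ≤ x * y
    0≉1             : 0# ≉ 1#
    -- Total for convenience; nothing is assumed about the value at 0#.
    _⁻¹             : Carrier → Carrier
    ⁻¹-inverseʳ     : ∀ x → x ≉ 0# → x * x ⁻¹ ≈ 1#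
    archimedean     : ∀ x → ∃[ n ] x ≤ fromℕ n
    complete        : (P : Pred Carrier (c ⊔ ℓ₁ ⊔ ℓ₂)) →
                      ∃ P → ∃ (IsUpperBound _≤_ P) → ∃ (IsSupremum _≤_ P)

  open NonStrictToStrict _≈_ _≤_ public using (_<_)

  -- The order on Carrier ⁺, where ⊤⁺ plays the role of +∞.
  open AddSupremum _≤_ public using (_≤⁺_)

  _/_ : Carrier → Carrier → Carrier
  x / y = x * y ⁻¹

  _/⁺_ : Carrier ⁺ → Carrier → Carrier ⁺
  [ x ] /⁺ y = [ x / y ]
  ⊤⁺    /⁺ y = ⊤⁺

module StarSearch (ℝ : RealField c ℓ₁ ℓ₂) (m : ℕ) where
  open RealField ℝ

  ρ* : Carrier
  ρ* = fromℕ m ^ m / (fromℕ m - 1#) ^ (m ∸ 1)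

  r* : Carrier
  r* = 1# + fromℕ 2 * ρ*

  ρ : Carrier → Carrier
  ρ r = (r - 1#) / fromℕ 2

  -- The side condition x ≉ 1# excludes the point where x ^ m / (x - 1#)
  -- is undefined.
  IsRoot : Carrier → Carrier → Set ℓ₁
  IsRoot r x = (x ≉ 1#) × (x ^ m / (x - 1#) - ρ r ≈ 0#)

  IsLargestRoot : Carrier → Carrier → Set (c ⊔ ℓ₁ ⊔ ℓ₂)
  IsLargestRoot r = IsGreatest _≤_ (IsRoot r)

  record SearchStrategy : Set (c ⊔ ℓ₁ ⊔ ℓ₂) where
    field
      length   : ℕ → Carrier
      ray      : ℕ → Fin m
      positive : ∀ i → 0# < length i

  module _ (d₀ : Carrier) where

    record Position : Set (c ⊔ ℓ₂) where
      field
        distance : Carrier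
        ray      : Fin m
        far      : d₀ ≤ distance

    Reaches : SearchStrategy → Position → ℕ → Set ℓ₂
    Reaches X t i = (X.ray i ≡ t.ray) × (t.distance ≤ X.length i)
      where
      module X = SearchStrategy X
      module t = Position t

    -- Iterations before the i-th are walked out and back; in the i-th the
    -- searcher stops on reaching the target.
    walked : SearchStrategy → Position → ℕ → Carrier
    walked X t i =
      fromℕ 2 * sum {i} (λ j → SearchStrategy.length X (toℕ j)) +
      Position.distance t

    -- Cost X t δ says that d(X, t) = δ.
    data Cost (X : SearchStrategy) (t : Position) : Carrier ⁺ → Set (c ⊔ ℓ₂) where
      found  : ∀ i → Reaches X t i → (∀ j → j ℕ.< i → ¬ Reaches X t j) →
               Cost X t [ walked X t i ]
      missed : (∀ i → ¬ Reaches X t i) → Cost X t ⊤⁺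

    PredictionStrategy : Set (c ⊔ ℓ₁ ⊔ ℓ₂)
    PredictionStrategy = Position → SearchStrategy

    data ConsistencyRatio (S : PredictionStrategy) : Carrier ⁺ → Set (c ⊔ ℓ₂) where
      ratio : ∀ h {δ} → Cost (S h) h δ →
              ConsistencyRatio S (δ /⁺ Position.distance h)

    data RobustnessRatio (S : PredictionStrategy) : Carrier ⁺ → Set (c ⊔ ℓ₂) where
      ratio : ∀ h t {δ} → Cost (S h) t δ →
              RobustnessRatio S (δ /⁺ Position.distance t)

    IsConsistency : PredictionStrategy → Carrier ⁺ → Set (c ⊔ ℓ₂)
    IsConsistency S = IsSupremum _≤⁺_ (ConsistencyRatio S)

    IsRobustness : PredictionStrategy → Carrier ⁺ → Set (c ⊔ ℓ₂)
    IsRobustness S = IsSupremum _≤⁺_ (RobustnessRatio S)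

    ConsistencyAtMost : PredictionStrategy → Carrier → Set (c ⊔ ℓ₂)
    ConsistencyAtMost S x = ∃[ s ] IsConsistency S s × s ≤⁺ [ x ]

    Robust : Carrier → PredictionStrategy → Set (c ⊔ ℓ₂)
    Robust r S = ∃[ s ] IsRobustness S s × s ≤⁺ [ r ]

{-# OPTIONS --safe #-}
-- Predictions are handled by the cyclic geometric search of base b = b_r, rescaled
-- and rotated so that the iteration of some index k visits the predicted ray and
-- turns back exactly at the predicted distance. The iterations before k then cost at
-- most 2 d_h / (b - 1), which gives the consistency. Rescaling preserves the ratio
-- 1 + 2 b^m / (b - 1) ≤ r for every target that is missed by an earlier iteration on
-- its ray; taking k so large that the first length is at most d₀ extends it to the
-- targets found in the first m iterations. The root b = 1 + β is obtained from the
-- completeness of ℝ: β is the supremum of the y ≥ 0 with (1 + y)^m ≤ ρ y.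

module Submission where

open import Level using (Level; _⊔_; Lift; lift; lower)
open import Data.Empty using (⊥-elim)
open import Data.Fin.Base using (Fin; toℕ)
import Data.Fin.Properties as Fin
open import Data.Nat.Base as ℕ using (ℕ; zero; suc; NonZero; s≤s; z≤n; _∸_) renaming (_≤_ to _≤ℕ_)
open import Data.Nat.DivMod using (_mod_; _%_; [m+kn]%n≡m%n; m<n⇒m%n≡m)
import Data.Nat.Properties as ℕ
open import Data.Product.Base using (∃-syntax; _×_; _,_; proj₁; proj₂)
open import Data.Sum.Base using (inj₁; inj₂)
open import Function.Base using (_∘_; case_of_)
open import Relation.Binary.Bundles using (DecTotalOrder)
open import Relation.Binary.Construct.Add.Supremum.NonStrict using ([_]; _≤⊤⁺; [≤]-injective; ≤⁺-trans)
open import Relation.Binary.PropositionalEquality.Core as ≡ using (_≡_)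
open import Relation.Nullary.Construct.Add.Supremum using (_⁺; [_]; ⊤⁺)
open import Relation.Nullary.Decidable.Core using (yes; no; _×-dec_)
open import Relation.Nullary.Negation.Core using (¬_)
open import Relation.Unary using (Pred; Decidable)
open import Defs
import Algebra.Solver.Ring.NaturalCoefficients.Default as SemiringSolver
import Algebra.Properties.Ring as RingProperties
import Algebra.Properties.CommutativeSemiring.Exp as Exp
import Relation.Binary.Reasoning.PartialOrder as PosetReasoning
import Relation.Binary.Properties.DecTotalOrder as DecTotalOrderProperties
import Relation.Binary.Construct.NonStrictToStrict as NonStrictToStrict

private
  variable
    p c ℓ₁ ℓ₂ : Level

-- Least witnesses and residues modulo m.

least-witness : {P : Pred ℕ p} → Decidable P → ∀ n → P n →
                ∃[ i ] P i × (∀ j → j ℕ.< i → ¬ P j)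
least-witness P? n Pn with P? 0
... | yes P0 = 0 , P0 , λ _ ()
least-witness P? zero    Pn | no ¬P0 = ⊥-elim (¬P0 Pn)
least-witness P? (suc n) Pn | no ¬P0 =
  let i , Pi , min = least-witness (P? ∘ suc) n Pn
  in suc i , Pi , λ { zero _ → ¬P0 ; (suc j) (s≤s j<i) → min j j<i }

mod-cong : ∀ {i j} m .{{_ : NonZero m}} → i % m ≡ j % m → i mod m ≡ j mod m
mod-cong m eq = Fin.toℕ-injective
  (≡.trans (Fin.toℕ-fromℕ< _) (≡.trans eq (≡.sym (Fin.toℕ-fromℕ< _))))

-- Supplies, for growing `k`, arbitrarily late indices that fall on a prescribed ray.
toℕ+km-mod : ∀ {m} .{{_ : NonZero m}} (u : Fin m) k → (toℕ u ℕ.+ k ℕ.* m) mod m ≡ u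
toℕ+km-mod {m} u k = Fin.toℕ-injective (≡.trans (Fin.toℕ-fromℕ< _)
  (≡.trans ([m+kn]%n≡m%n (toℕ u) k m) (m<n⇒m%n≡m (Fin.toℕ<n u))))

-- Arithmetic and order in the real field.

module OrderedField (ℝ : RealField c ℓ₁ ℓ₂) where
  open RealField ℝ
  open RingProperties ring using (-‿distribˡ-*; -‿involutive; //-rightDividesˡ; //-rightDividesʳ)
  open RingProperties ring public using () renaming (x∙y⁻¹≈ε⇒x≈y to x-y≈0⇒x≈y)
  open Exp commutativeSemiring using (^-congˡ; ^-distrib-*; ^-homo-*) public

  decTotalOrder : DecTotalOrder _ _ _
  decTotalOrder = record { isDecTotalOrder = isDecTotalOrder }

  open DecTotalOrder decTotalOrder public
    using (poset; total; _≤?_; antisym; ≤-respˡ-≈; ≤-respʳ-≈)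
    renaming (refl to ≤-refl; trans to ≤-trans; reflexive to ≤-reflexive)
  open DecTotalOrderProperties decTotalOrder public using (≰⇒>; ≮⇒≥)
  open NonStrictToStrict _≈_ _≤_ public using (<⇒≤)
  open PosetReasoning poset public
  open SemiringSolver commutativeSemiring public
    using (solve; _:+_; _:*_; _:=_; con)

  <⇒≱ : ∀ {x y} → x < y → ¬ y ≤ x
  <⇒≱ = NonStrictToStrict.<⇒≱ _≈_ _≤_ antisym

  <-≤-trans : ∀ {x y z} → x < y → y ≤ z → x < z
  <-≤-trans {x} {y} {z} x<y y≤z = begin-strict x <⟨ x<y ⟩ y ≤⟨ y≤z ⟩ z ∎

  x-y+y≈x : ∀ x y → (x - y) + y ≈ x
  x-y+y≈x x y = //-rightDividesˡ y x

  x+y-y≈x : ∀ x y → (x + y) - y ≈ x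
  x+y-y≈x x y = //-rightDividesʳ y x

  +-monoʳ-≤ : ∀ z {x y} → x ≤ y → z + x ≤ z + y
  +-monoʳ-≤ z {x} {y} x≤y = begin
    z + x ≈⟨ +-comm z x ⟩
    x + z ≤⟨ +-monoˡ-≤ z x≤y ⟩
    y + z ≈⟨ +-comm y z ⟩
    z + y ∎

  +-mono-≤ : ∀ {w x y z} → w ≤ x → y ≤ z → w + y ≤ x + z
  +-mono-≤ w≤x y≤z = ≤-trans (+-monoˡ-≤ _ w≤x) (+-monoʳ-≤ _ y≤z)

  +-cancelʳ-≤ : ∀ z {x y} → x + z ≤ y + z → x ≤ y
  +-cancelʳ-≤ z {x} {y} le = begin
    x           ≈⟨ x+y-y≈x x z ⟨
    (x + z) - z ≤⟨ +-monoˡ-≤ (- z) le ⟩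
    (y + z) - z ≈⟨ x+y-y≈x y z ⟩
    y           ∎

  x≤x+y : ∀ x {y} → 0# ≤ y → x ≤ x + y
  x≤x+y x {y} 0≤y = begin
    x      ≈⟨ +-identityʳ x ⟨
    x + 0# ≤⟨ +-monoʳ-≤ x 0≤y ⟩
    x + y  ∎

  0≤y-x : ∀ {x y} → x ≤ y → 0# ≤ y - x
  0≤y-x {x} {y} x≤y = begin
    0#    ≈⟨ -‿inverseʳ x ⟨
    x - x ≤⟨ +-monoˡ-≤ (- x) x≤y ⟩
    y - x ∎

  x+y≰x : ∀ {x y} → 0# < y → ¬ x + y ≤ x
  x+y≰x {x} {y} 0<y x+y≤x = <⇒≱ 0<y (+-cancelʳ-≤ x (begin
    y + x  ≈⟨ +-comm y x ⟩
    x + y  ≤⟨ x+y≤x ⟩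
    x      ≈⟨ +-identityˡ x ⟨
    0# + x ∎))

  0<y-x : ∀ {x y} → x < y → 0# < y - x
  0<y-x {x} {y} x<y = 0≤y-x (<⇒≤ x<y) , λ 0≈y-x → proj₂ x<y (begin-equality
    x           ≈⟨ +-identityˡ x ⟨
    0# + x      ≈⟨ +-congʳ 0≈y-x ⟩
    (y - x) + x ≈⟨ x-y+y≈x y x ⟩
    y           ∎)

  +-nonNegative : ∀ {x y} → 0# ≤ x → 0# ≤ y → 0# ≤ x + y
  +-nonNegative 0≤x 0≤y = ≤-trans 0≤x (x≤x+y _ 0≤y)

  +-positiveˡ : ∀ {x y} → 0# < x → 0# ≤ y → 0# < x + y
  +-positiveˡ 0<x 0≤y = <-≤-trans 0<x (x≤x+y _ 0≤y)

  *-monoʳ-≤ : ∀ {x y z} → 0# ≤ z → x ≤ y → x * z ≤ y * z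
  *-monoʳ-≤ {x} {y} {z} 0≤z x≤y = begin
    x * z                     ≤⟨ x≤x+y _ (*-nonNegative (0≤y-x x≤y) 0≤z) ⟩
    x * z + (y - x) * z       ≈⟨ solve 3 (λ x w z → x :* z :+ w :* z := (w :+ x) :* z) refl x (y - x) z ⟩
    ((y - x) + x) * z         ≈⟨ *-congʳ (x-y+y≈x y x) ⟩
    y * z                     ∎

  *-monoˡ-≤ : ∀ {x y z} → 0# ≤ z → x ≤ y → z * x ≤ z * y
  *-monoˡ-≤ {x} {y} {z} 0≤z x≤y = begin
    z * x ≈⟨ *-comm z x ⟩
    x * z ≤⟨ *-monoʳ-≤ 0≤z x≤y ⟩
    y * z ≈⟨ *-comm y z ⟩
    z * y ∎

  *-mono-≤ : ∀ {w x y z} → 0# ≤ w → 0# ≤ z → w ≤ x → y ≤ z → w * y ≤ x * z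
  *-mono-≤ 0≤w 0≤z w≤x y≤z = ≤-trans (*-monoˡ-≤ 0≤w y≤z) (*-monoʳ-≤ 0≤z w≤x)

  0<1 : 0# < 1#
  0<1 with total 0# 1#
  ... | inj₁ 0≤1 = 0≤1 , 0≉1
  -- Even if 1 ≤ 0, then 0 ≤ -1 and 1 is the square of -1, so 0 ≤ 1 all the same.
  ... | inj₂ 1≤0 = (begin
    0#            ≤⟨ *-nonNegative 0≤-1 0≤-1 ⟩
    - 1# * - 1#   ≈⟨ -‿distribˡ-* 1# (- 1#) ⟨
    - (1# * - 1#) ≈⟨ -‿cong (*-identityˡ (- 1#)) ⟩
    - - 1#        ≈⟨ -‿involutive 1# ⟩
    1#            ∎) , 0≉1
    where
    0≤-1 : 0# ≤ - 1#
    0≤-1 = ≤-respʳ-≈ (+-identityˡ (- 1#)) (0≤y-x 1≤0)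

  <⇒≉0 : ∀ {x} → 0# < x → x ≉ 0#
  <⇒≉0 (_ , 0≉x) x≈0 = 0≉x (sym x≈0)

  ⁻¹-positive : ∀ {x} → 0# < x → 0# < x ⁻¹
  ⁻¹-positive {x} 0<x = ≰⇒> λ x⁻¹≤0 → <⇒≱ 0<1 (begin
    1#       ≈⟨ ⁻¹-inverseʳ x (<⇒≉0 0<x) ⟨
    x * x ⁻¹ ≤⟨ *-monoˡ-≤ (<⇒≤ 0<x) x⁻¹≤0 ⟩
    x * 0#   ≈⟨ zeroʳ x ⟩
    0#       ∎)

  x*z/z≈x : ∀ x {z} → z ≉ 0# → (x * z) / z ≈ x
  x*z/z≈x x {z} z≉0 = begin-equality
    (x * z) * z ⁻¹ ≈⟨ *-assoc x z (z ⁻¹) ⟩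
    x * (z * z ⁻¹) ≈⟨ *-congˡ (⁻¹-inverseʳ z z≉0) ⟩
    x * 1#         ≈⟨ *-identityʳ x ⟩
    x              ∎

  x/z*z≈x : ∀ x {z} → z ≉ 0# → (x / z) * z ≈ x
  x/z*z≈x x {z} z≉0 = begin-equality
    (x * z ⁻¹) * z ≈⟨ solve 3 (λ x y z → (x :* y) :* z := (x :* z) :* y) refl x (z ⁻¹) z ⟩
    (x * z) * z ⁻¹ ≈⟨ x*z/z≈x x z≉0 ⟩
    x              ∎

  *-cancelʳ-≤ : ∀ {x y z} → 0# < z → x * z ≤ y * z → x ≤ y
  *-cancelʳ-≤ {x} {y} {z} 0<z le = begin
    x           ≈⟨ x*z/z≈x x (<⇒≉0 0<z) ⟨
    (x * z) / z ≤⟨ *-monoʳ-≤ (<⇒≤ (⁻¹-positive 0<z)) le ⟩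
    (y * z) / z ≈⟨ x*z/z≈x y (<⇒≉0 0<z) ⟩
    y           ∎

  x≤y*z⇒x/z≤y : ∀ {x y z} → 0# < z → x ≤ y * z → x / z ≤ y
  x≤y*z⇒x/z≤y {x} 0<z x≤yz = *-cancelʳ-≤ 0<z (≤-respˡ-≈ (sym (x/z*z≈x x (<⇒≉0 0<z))) x≤yz)

  *-positive : ∀ {x y} → 0# < x → 0# < y → 0# < x * y
  *-positive {x} {y} 0<x 0<y = ≰⇒> λ xy≤0 →
    <⇒≱ 0<x (*-cancelʳ-≤ 0<y (≤-respʳ-≈ (sym (zeroˡ y)) xy≤0))

  /-positive : ∀ {x y} → 0# < x → 0# < y → 0# < x / y
  /-positive 0<x 0<y = *-positive 0<x (⁻¹-positive 0<y)

  ^-positive : ∀ {x} n → 0# < x → 0# < x ^ n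
  ^-positive zero    0<x = 0<1
  ^-positive (suc n) 0<x = *-positive 0<x (^-positive n 0<x)

  ^-nonNegative : ∀ {x} n → 0# ≤ x → 0# ≤ x ^ n
  ^-nonNegative zero    0≤x = <⇒≤ 0<1
  ^-nonNegative (suc n) 0≤x = *-nonNegative 0≤x (^-nonNegative n 0≤x)

  ^-monoˡ-≤ : ∀ {x y} n → 0# ≤ x → x ≤ y → x ^ n ≤ y ^ n
  ^-monoˡ-≤ zero    0≤x x≤y = ≤-refl
  ^-monoˡ-≤ (suc n) 0≤x x≤y =
    *-mono-≤ 0≤x (^-nonNegative n (≤-trans 0≤x x≤y)) x≤y (^-monoˡ-≤ n 0≤x x≤y)

  1≤x⇒1≤x^n : ∀ {x} n → 1# ≤ x → 1# ≤ x ^ n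
  1≤x⇒1≤x^n zero    1≤x = ≤-refl
  1≤x⇒1≤x^n {x} (suc n) 1≤x = begin
    1#        ≈⟨ *-identityˡ 1# ⟨
    1# * 1#   ≤⟨ *-mono-≤ (<⇒≤ 0<1) (^-nonNegative n (≤-trans (<⇒≤ 0<1) 1≤x)) 1≤x (1≤x⇒1≤x^n n 1≤x) ⟩
    x * x ^ n ∎

  ^-monoʳ-≤ : ∀ {x m n} → 1# ≤ x → m ≤ℕ n → x ^ m ≤ x ^ n
  ^-monoʳ-≤ {n = n} 1≤x z≤n       = 1≤x⇒1≤x^n n 1≤x
  ^-monoʳ-≤         1≤x (s≤s m≤n) = *-monoˡ-≤ (≤-trans (<⇒≤ 0<1) 1≤x) (^-monoʳ-≤ 1≤x m≤n)

  -- Natural multiples, growth of powers and geometric sums.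

  fromℕ-nonNegative : ∀ n → 0# ≤ fromℕ n
  fromℕ-nonNegative zero    = ≤-refl
  fromℕ-nonNegative (suc n) = +-nonNegative (<⇒≤ 0<1) (fromℕ-nonNegative n)

  fromℕ-positive : ∀ n → 0# < fromℕ (suc n)
  fromℕ-positive n = +-positiveˡ 0<1 (fromℕ-nonNegative n)

  bernoulli : ∀ {y} → 0# ≤ y → ∀ n → 1# + fromℕ n * y ≤ (1# + y) ^ n
  bernoulli {y} 0≤y zero = ≤-reflexive
    (trans (+-congˡ (zeroˡ y)) (+-identityʳ 1#))
  bernoulli {y} 0≤y (suc n) = begin
    -- The added term N y² completes the product (1 + y)(1 + N y).
    1# + (1# + N) * y               ≤⟨ x≤x+y _ (*-nonNegative (*-nonNegative (fromℕ-nonNegative n) 0≤y) 0≤y) ⟩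
    (1# + (1# + N) * y) + (N * y) * y ≈⟨ solve 2 (λ N y → (con 1 :+ (con 1 :+ N) :* y) :+ (N :* y) :* y
                                          := (con 1 :+ y) :* (con 1 :+ N :* y)) refl N y ⟩
    (1# + y) * (1# + N * y)         ≤⟨ *-monoˡ-≤ (+-nonNegative (<⇒≤ 0<1) 0≤y) (bernoulli 0≤y n) ⟩
    (1# + y) * (1# + y) ^ n         ∎
    where N = fromℕ n

  -- Bernoulli's inequality turns an Archimedean bound n for x / y into an exponent.
  ^-unbounded : ∀ {y} → 0# < y → ∀ x → ∃[ n ] x ≤ (1# + y) ^ n
  ^-unbounded {y} 0<y x with archimedean (x / y)
  ... | n , x/y≤n = n , (begin
    x                ≈⟨ x/z*z≈x x (<⇒≉0 0<y) ⟨
    (x / y) * y      ≤⟨ *-monoʳ-≤ (<⇒≤ 0<y) x/y≤n ⟩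
    fromℕ n * y      ≤⟨ x≤x+y _ (<⇒≤ 0<1) ⟩
    fromℕ n * y + 1# ≈⟨ +-comm _ 1# ⟩
    1# + fromℕ n * y ≤⟨ bernoulli (<⇒≤ 0<y) n ⟩
    (1# + y) ^ n     ∎)

  -- Free of division and subtraction, and stated for any sequence of ratio 1 + β, so that the
  -- induction can pass to the shifted sequence `f ∘ suc`.
  sum-geometric : ∀ {β} (f : ℕ → Carrier) → (∀ i → f (suc i) ≈ (1# + β) * f i) →
                  ∀ n → β * sum {n} (f ∘ toℕ) + f 0 ≈ f n
  sum-geometric {β} f step zero = trans (+-congʳ (zeroʳ β)) (+-identityˡ (f 0))
  sum-geometric {β} f step (suc n) = begin-equality
    β * (f 0 + S) + f 0     ≈⟨ solve 3 (λ β x S → β :* (x :+ S) :+ x := β :* S :+ (con 1 :+ β) :* x) refl β (f 0) S ⟩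
    β * S + (1# + β) * f 0  ≈⟨ +-congˡ (step 0) ⟨
    β * S + f 1             ≈⟨ sum-geometric (f ∘ suc) (step ∘ suc) n ⟩
    f (suc n)               ∎
    where S = sum {n} (f ∘ suc ∘ toℕ)

  -- Tools for completeness: Lipschitz bounds for powers, small multiples, suprema in the extended
  -- order.

  lipschitz : Carrier → ℕ → Carrier
  lipschitz M zero    = 0#
  -- Unfolded, this is (n + 1) M^n, the largest slope of x^(n + 1) on [0, M], in the shape that the
  -- induction of `^-lipschitz` produces.
  lipschitz M (suc n) = M * lipschitz M n + M ^ n

  lipschitz-nonNegative : ∀ {M} → 0# ≤ M → ∀ n → 0# ≤ lipschitz M n
  lipschitz-nonNegative 0≤M zero    = ≤-refl
  lipschitz-nonNegative 0≤M (suc n) =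
    +-nonNegative (*-nonNegative 0≤M (lipschitz-nonNegative 0≤M n)) (^-nonNegative n 0≤M)

  -- Serves as continuity of powers in both halves of `supremum-solves`: `e` is first a small step
  -- above β, then the gap from a member of the set up to β. The induction expands one factor and
  -- bounds both `x + e` and `x` by `M`.
  ^-lipschitz : ∀ {M x e} → 0# ≤ x → 0# ≤ e → x + e ≤ M → ∀ n →
                (x + e) ^ n ≤ x ^ n + lipschitz M n * e
  ^-lipschitz {e = e} 0≤x 0≤e x+e≤M zero = x≤x+y _ (≤-reflexive (sym (zeroˡ e)))
  ^-lipschitz {M} {x} {e} 0≤x 0≤e x+e≤M (suc n) = begin
    (x + e) * (x + e) ^ n
      ≤⟨ *-monoˡ-≤ 0≤x+e (^-lipschitz 0≤x 0≤e x+e≤M n) ⟩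
    (x + e) * (x ^ n + L * e)
      ≈⟨ solve 4 (λ x e y L → (x :+ e) :* (y :+ L :* e) := x :* y :+ ((x :+ e) :* L :+ y) :* e) refl x e (x ^ n) L ⟩
    x * x ^ n + ((x + e) * L + x ^ n) * e
      ≤⟨ +-monoʳ-≤ _ (*-monoʳ-≤ 0≤e (+-mono-≤ (*-monoʳ-≤ (lipschitz-nonNegative 0≤M n) x+e≤M)
                                              (^-monoˡ-≤ n 0≤x (≤-trans (x≤x+y x 0≤e) x+e≤M)))) ⟩
    x * x ^ n + (M * L + M ^ n) * e ∎
    where
    L = lipschitz M n
    0≤x+e = +-nonNegative 0≤x 0≤e
    0≤M = ≤-trans 0≤x+e x+e≤M

  small-multiple : ∀ {δ K} → 0# < δ → 0# ≤ K → ∃[ ε ] 0# < ε × ε ≤ 1# × K * ε < δ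
  small-multiple {δ} {K} 0<δ 0≤K = ε , 0<ε , ε≤1 , Kε<δ
    where
    -- This denominator exceeds δ, hence ε ≤ 1, and splits δ into K ε and a positive remainder (1 +
    -- δ) ε, hence K ε < δ.
    D = (1# + δ) + K

    0<D : 0# < D
    0<D = +-positiveˡ (+-positiveˡ 0<1 (<⇒≤ 0<δ)) 0≤K

    ε = δ / D
    0<ε = /-positive 0<δ 0<D

    δ≈ : δ ≈ K * ε + (1# + δ) * ε
    δ≈ = begin-equality
      δ                    ≈⟨ x/z*z≈x δ (<⇒≉0 0<D) ⟨
      ε * D                ≈⟨ solve 3 (λ ε a K → ε :* (a :+ K) := K :* ε :+ a :* ε) refl ε (1# + δ) K ⟩
      K * ε + (1# + δ) * ε ∎

    ε≤1 : ε ≤ 1#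
    ε≤1 = x≤y*z⇒x/z≤y 0<D (begin
      δ              ≤⟨ x≤x+y δ (+-nonNegative (<⇒≤ 0<1) 0≤K) ⟩
      δ + (1# + K)   ≈⟨ solve 2 (λ δ K → δ :+ (con 1 :+ K) := con 1 :* ((con 1 :+ δ) :+ K)) refl δ K ⟩
      1# * D         ∎)

    Kε<δ : K * ε < δ
    Kε<δ = ≰⇒> λ δ≤Kε → x+y≰x (*-positive (+-positiveˡ 0<1 (<⇒≤ 0<δ)) 0<ε)
      (≤-respˡ-≈ δ≈ δ≤Kε)

  -- The finite bound keeps `⊤⁺` out of `R`, so completeness applied to the finite members yields
  -- the supremum. `Lift` moves the predicate to the level at which `complete` is stated.
  supremum⁺ : (R : Pred (Carrier ⁺) (c ⊔ ℓ₂)) → ∃[ x ] R [ x ] →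
              ∀ u → IsUpperBound _≤⁺_ R [ u ] →
              ∃[ s ] IsSupremum _≤⁺_ R s × s ≤⁺ [ u ]
  supremum⁺ R (x , Rx) u bound = [ s ] , (upper , least) , least [ u ] bound
    where
    sup = complete (λ x → Lift (c ⊔ ℓ₁ ⊔ ℓ₂) (R [ x ])) (x , lift Rx)
                   (u , λ y Ry → [≤]-injective _ (bound [ y ] (lower Ry)))
    s = proj₁ sup

    upper : IsUpperBound _≤⁺_ R [ s ]
    upper [ y ] Ry = [ proj₁ (proj₂ sup) y (lift Ry) ]
    upper ⊤⁺    R⊤ with () ← bound ⊤⁺ R⊤

    least : ∀ v → IsUpperBound _≤⁺_ R v → [ s ] ≤⁺ v
    least [ v ] ub = [ proj₂ (proj₂ sup) v (λ y Ry → [≤]-injective _ (ub [ y ] (lower Ry))) ]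
    least ⊤⁺    ub = [ s ] ≤⊤⁺

  -- The largest solution of (1 + y)^m = ρ y.

  module _ (m : ℕ) (2≤m : 2 ≤ℕ m) {ρ : Carrier} (0≤ρ : 0# ≤ ρ) where

    private
      -- The inequality x^m / (x - 1) ≤ ρ at x = 1 + y, cleared of its denominator.
      Sublevel : Pred Carrier (c ⊔ ℓ₁ ⊔ ℓ₂)
      Sublevel y = Lift (c ⊔ ℓ₁ ⊔ ℓ₂) (0# ≤ y × (1# + y) ^ m ≤ ρ * y)

      sublevel-positive : ∀ {y} → Sublevel y → 0# < y
      sublevel-positive {y} (lift (0≤y , le)) = ≰⇒> λ y≤0 → <⇒≱ 0<1 (begin
        1#            ≤⟨ 1≤x⇒1≤x^n m (x≤x+y 1# 0≤y) ⟩
        (1# + y) ^ m  ≤⟨ le ⟩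
        ρ * y         ≤⟨ *-monoˡ-≤ 0≤ρ y≤0 ⟩
        ρ * 0#        ≈⟨ zeroʳ ρ ⟩
        0#            ∎)

      -- As m ≥ 2, y² ≤ (1 + y)² ≤ (1 + y)^m ≤ ρ y, and the positive y cancels.
      sublevel-bounded : IsUpperBound _≤_ Sublevel ρ
      sublevel-bounded y Qy@(lift (0≤y , le)) = *-cancelʳ-≤ (sublevel-positive Qy) (begin
        y * y                    ≤⟨ *-mono-≤ 0≤y (+-nonNegative (<⇒≤ 0<1) 0≤y) y≤1+y y≤1+y ⟩
        (1# + y) * (1# + y)      ≈⟨ *-congˡ (*-identityʳ (1# + y)) ⟨
        (1# + y) ^ 2             ≤⟨ ^-monoʳ-≤ (x≤x+y 1# 0≤y) 2≤m ⟩
        (1# + y) ^ m             ≤⟨ le ⟩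
        ρ * y                    ∎)
        where
        y≤1+y : y ≤ 1# + y
        y≤1+y = ≤-respʳ-≈ (+-comm y 1#) (x≤x+y y (<⇒≤ 0<1))

    -- If the power were below ρ β, a point slightly above β would still lie in the set; if it were
    -- above, no member would lie within some ε of β, and β - ε would be a smaller upper bound.
    supremum-solves : ∀ {β} → 0# < β → IsSupremum _≤_ Sublevel β → (1# + β) ^ m ≈ ρ * β
    supremum-solves {β} 0<β (upper , least) = antisym (≮⇒≥ ρβ≮) (≮⇒≥ ≮ρβ)
      where
      -- Room for steps ε ≤ 1 beyond 1 + β.
      M = (1# + β) + 1#

      0≤M : 0# ≤ M
      0≤M = +-nonNegative (+-nonNegative (<⇒≤ 0<1) (<⇒≤ 0<β)) (<⇒≤ 0<1)

      K = lipschitz M m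
      0≤K = lipschitz-nonNegative 0≤M m

      ≮ρβ : ¬ (1# + β) ^ m < ρ * β
      ≮ρβ lt = case small-multiple (0<y-x lt) 0≤K of λ { (ε , 0<ε , ε≤1 , Kε<δ) → x+y≰x 0<ε (upper (β + ε)
        (lift (+-nonNegative (<⇒≤ 0<β) (<⇒≤ 0<ε) , (begin
          (1# + (β + ε)) ^ m                       ≈⟨ ^-congˡ m (+-assoc 1# β ε) ⟨
          ((1# + β) + ε) ^ m                       ≤⟨ ^-lipschitz (+-nonNegative (<⇒≤ 0<1) (<⇒≤ 0<β)) (<⇒≤ 0<ε) (+-monoʳ-≤ _ ε≤1) m ⟩
          (1# + β) ^ m + K * ε                     ≤⟨ +-monoʳ-≤ _ (<⇒≤ Kε<δ) ⟩
          (1# + β) ^ m + (ρ * β - (1# + β) ^ m)    ≈⟨ +-comm ((1# + β) ^ m) _ ⟩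
          (ρ * β - (1# + β) ^ m) + (1# + β) ^ m    ≈⟨ x-y+y≈x (ρ * β) ((1# + β) ^ m) ⟩
          ρ * β                                    ≤⟨ *-monoˡ-≤ 0≤ρ (x≤x+y β (<⇒≤ 0<ε)) ⟩
          ρ * (β + ε)                              ∎)))) }

      ρβ≮ : ¬ ρ * β < (1# + β) ^ m
      ρβ≮ lt = case small-multiple (0<y-x lt) 0≤K of λ { (ε , 0<ε , _ , Kε<δ) → x+y≰x 0<ε (begin
        β + ε        ≤⟨ +-monoˡ-≤ ε (least (β - ε) (β-ε-upper Kε<δ)) ⟩
        (β - ε) + ε  ≈⟨ x-y+y≈x β ε ⟩
        β            ∎) }
        where
        β-ε-upper : ∀ {ε} → K * ε < (1# + β) ^ m - ρ * β → IsUpperBound _≤_ Sublevel (β - ε)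
        β-ε-upper {ε} Kε<δ y Qy@(lift (0≤y , le)) = +-cancelʳ-≤ ε (begin
          y + ε        ≤⟨ +-monoʳ-≤ y ε≤e ⟩
          y + e        ≈⟨ y+e≈β ⟩
          β            ≈⟨ x-y+y≈x β ε ⟨
          (β - ε) + ε  ∎)
          where
          e = β - y
          0≤e = 0≤y-x (upper y Qy)

          y+e≈β : y + e ≈ β
          y+e≈β = trans (+-comm y e) (x-y+y≈x β y)

          1+y+e≈1+β : (1# + y) + e ≈ 1# + β
          1+y+e≈1+β = trans (+-assoc 1# y e) (+-congˡ y+e≈β)

          -- At y the power is at most ρ y ≤ ρ β, so going up by e to β must make up the whole
          -- excess over ρ β; since K ε is less than that excess, e cannot be below ε.
          δ≤Ke : (1# + β) ^ m - ρ * β ≤ K * e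
          δ≤Ke = +-cancelʳ-≤ (ρ * β) (begin
            ((1# + β) ^ m - ρ * β) + ρ * β ≈⟨ x-y+y≈x ((1# + β) ^ m) (ρ * β) ⟩
            (1# + β) ^ m                   ≈⟨ ^-congˡ m 1+y+e≈1+β ⟨
            ((1# + y) + e) ^ m             ≤⟨ ^-lipschitz (+-nonNegative (<⇒≤ 0<1) 0≤y) 0≤e
                                                (≤-respˡ-≈ (sym 1+y+e≈1+β) (x≤x+y _ (<⇒≤ 0<1))) m ⟩
            (1# + y) ^ m + K * e           ≤⟨ +-monoˡ-≤ _ (≤-trans le (*-monoˡ-≤ 0≤ρ (upper y Qy))) ⟩
            ρ * β + K * e                  ≈⟨ +-comm (ρ * β) (K * e) ⟩
            K * e + ρ * β                  ∎)

          ε≤e : ε ≤ e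
          ε≤e = ≮⇒≥ λ e<ε → <⇒≱ Kε<δ (≤-trans δ≤Ke (*-monoˡ-≤ 0≤K (<⇒≤ e<ε)))

    -- The given point makes the set non-empty and, being itself positive, forces β > 0.
    largest-solution : (∃[ y ] 0# ≤ y × (1# + y) ^ m ≤ ρ * y) →
      ∃[ β ] 0# < β × (1# + β) ^ m ≈ ρ * β ×
             (∀ y → 0# ≤ y → (1# + y) ^ m ≤ ρ * y → y ≤ β)
    largest-solution (y₀ , Qy₀) =
      let β , sup@(upper , _) = complete Sublevel (y₀ , lift Qy₀) (ρ , sublevel-bounded)
          0<β = <-≤-trans (sublevel-positive (lift Qy₀)) (upper y₀ (lift Qy₀))
      in β , 0<β , supremum-solves 0<β sup , λ y 0≤y le → upper y (lift (0≤y , le))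

-- From the optimal ratio to the largest root b_r.

module StarSearchProperties (ℝ : RealField c ℓ₁ ℓ₂) (m : ℕ) (2≤m : 2 ≤ℕ m) where
  open RealField ℝ
  open OrderedField ℝ
  open StarSearch ℝ m

  private
    instance
      m-nonZero : NonZero m
      m-nonZero = ℕ.>-nonZero (ℕ.<-trans (s≤s z≤n) 2≤m)

    two = fromℕ 2

    0<two : 0# < two
    0<two = fromℕ-positive 1

    μ = fromℕ m - 1#

    1+μ≈m : 1# + μ ≈ fromℕ m
    1+μ≈m = trans (+-comm 1# μ) (x-y+y≈x (fromℕ m) 1#)

    0<μ : 0# < μ
    0<μ = positive 2≤m
      where
      -- Generalised from the parameter `m` to `k`, so that matching on the inequality exposes two
      -- successors.
      positive : ∀ {k} → 2 ≤ℕ k → 0# < fromℕ k - 1#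
      positive (s≤s (s≤s {n = k} z≤n)) = <-≤-trans (fromℕ-positive k) (≤-reflexive (begin-equality
        fromℕ (suc k)                ≈⟨ x+y-y≈x _ 1# ⟨
        (fromℕ (suc k) + 1#) - 1#    ≈⟨ +-congʳ (+-comm _ 1#) ⟩
        fromℕ (suc (suc k)) - 1#     ∎))

    m≡1+[m∸1] : m ≡ suc (m ∸ 1)
    m≡1+[m∸1] = ≡.sym (ℕ.suc-pred m)

  0≤ρ* : 0# ≤ ρ*
  0≤ρ* = <⇒≤ (/-positive (^-positive m 0<m) (^-positive (m ∸ 1) 0<μ))
    where
    0<m : 0# < fromℕ m
    0<m = <-≤-trans (+-positiveˡ 0<1 (<⇒≤ 0<μ)) (≤-reflexive 1+μ≈m)

  r≈1+2ρ : ∀ r → r ≈ 1# + two * ρ r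
  r≈1+2ρ r = begin-equality
    r                ≈⟨ x-y+y≈x r 1# ⟨
    (r - 1#) + 1#    ≈⟨ +-comm _ 1# ⟩
    1# + (r - 1#)    ≈⟨ +-congˡ (x/z*z≈x _ (<⇒≉0 0<two)) ⟨
    1# + ρ r * two   ≈⟨ +-congˡ (*-comm _ two) ⟩
    1# + two * ρ r   ∎

  ρ*≤ρ : ∀ {r} → r* ≤ r → ρ* ≤ ρ r
  ρ*≤ρ {r} r*≤r = *-cancelʳ-≤ 0<two (+-cancelʳ-≤ 1# (begin
    ρ* * two + 1#   ≈⟨ trans (+-comm _ 1#) (+-congˡ (*-comm _ two)) ⟩
    1# + two * ρ*   ≤⟨ r*≤r ⟩
    r               ≈⟨ r≈1+2ρ r ⟩
    1# + two * ρ r  ≈⟨ trans (+-congˡ (*-comm two _)) (+-comm 1# _) ⟩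
    ρ r * two + 1#  ∎))

  -- 1 + μ⁻¹ = m / (m - 1) is where x ^ m / (x - 1) attains its minimum ρ*.
  minimiser-bound : ∀ {ρ} → ρ* ≤ ρ → (1# + μ ⁻¹) ^ m ≤ ρ * μ ⁻¹
  minimiser-bound {ρ} ρ*≤ρ = *-cancelʳ-≤ (^-positive m 0<μ) (begin
    (1# + μ ⁻¹) ^ m * μ ^ m         ≈⟨ ^-distrib-* (1# + μ ⁻¹) μ m ⟨
    ((1# + μ ⁻¹) * μ) ^ m           ≈⟨ ^-congˡ m [1+μ⁻¹]μ≈m ⟩
    fromℕ m ^ m                     ≈⟨ x/z*z≈x _ (<⇒≉0 (^-positive (m ∸ 1) 0<μ)) ⟨
    ρ* * μ ^ (m ∸ 1)                ≤⟨ *-monoʳ-≤ (^-nonNegative (m ∸ 1) (<⇒≤ 0<μ)) ρ*≤ρ ⟩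
    ρ * μ ^ (m ∸ 1)                 ≈⟨ *-congʳ (*-identityʳ ρ) ⟨
    ρ * 1# * μ ^ (m ∸ 1)            ≈⟨ *-congʳ (*-congˡ (⁻¹-inverseʳ μ (<⇒≉0 0<μ))) ⟨
    ρ * (μ * μ ⁻¹) * μ ^ (m ∸ 1)    ≈⟨ solve 4 (λ ρ z i y → ρ :* (z :* i) :* y := ρ :* i :* (z :* y)) refl ρ μ (μ ⁻¹) (μ ^ (m ∸ 1)) ⟩
    ρ * μ ⁻¹ * μ ^ suc (m ∸ 1)      ≡⟨ ≡.cong (λ k → ρ * μ ⁻¹ * μ ^ k) m≡1+[m∸1] ⟨
    ρ * μ ⁻¹ * μ ^ m                ∎)
    where
    [1+μ⁻¹]μ≈m : (1# + μ ⁻¹) * μ ≈ fromℕ m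
    [1+μ⁻¹]μ≈m = begin-equality
      (1# + μ ⁻¹) * μ  ≈⟨ solve 2 (λ z i → (con 1 :+ i) :* z := z :* i :+ z) refl μ (μ ⁻¹) ⟩
      μ * μ ⁻¹ + μ     ≈⟨ +-congʳ (⁻¹-inverseʳ μ (<⇒≉0 0<μ)) ⟩
      1# + μ           ≈⟨ 1+μ≈m ⟩
      fromℕ m          ∎

  1+β-1≈β : ∀ β → (1# + β) - 1# ≈ β
  1+β-1≈β β = trans (+-congʳ (+-comm 1# β)) (x+y-y≈x β 1#)

  -- Roots may also lie below 1, but those are trivially smaller than 1 + β. A root x > 1 gives the
  -- solution y = x - 1, to which maximality of β applies.
  largest-solution⇒largest-root : ∀ {r β} → 0# < β → (1# + β) ^ m ≈ ρ r * β →
    (∀ y → 0# ≤ y → (1# + y) ^ m ≤ ρ r * y → y ≤ β) → IsLargestRoot r (1# + β)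
  largest-solution⇒largest-root {r} {β} 0<β eq largest = (1+β≉1 , root) , upper
    where
    1+β≉1 : 1# + β ≉ 1#
    1+β≉1 1+β≈1 = x+y≰x 0<β (≤-reflexive 1+β≈1)

    root : (1# + β) ^ m / ((1# + β) - 1#) - ρ r ≈ 0#
    root = begin-equality
      (1# + β) ^ m / ((1# + β) - 1#) - ρ r           ≈⟨ +-congʳ (*-congʳ (trans eq (*-congˡ (sym (1+β-1≈β β))))) ⟩
      (ρ r * ((1# + β) - 1#)) / ((1# + β) - 1#) - ρ r ≈⟨ +-congʳ (x*z/z≈x _ λ eq → <⇒≉0 0<β (trans (sym (1+β-1≈β β)) eq)) ⟩
      ρ r - ρ r                                      ≈⟨ -‿inverseʳ (ρ r) ⟩
      0#                                             ∎

    upper : IsUpperBound _≤_ (IsRoot r) (1# + β)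
    upper x (x≉1 , x-root) with x ≤? 1#
    ... | yes x≤1 = ≤-trans x≤1 (x≤x+y 1# (<⇒≤ 0<β))
    ... | no  x≰1 = begin
      x       ≈⟨ 1+y≈x ⟨
      1# + y  ≤⟨ +-monoʳ-≤ 1# (largest y (<⇒≤ 0<y) (≤-reflexive y-solution)) ⟩
      1# + β  ∎
      where
      y = x - 1#
      0<y = 0<y-x (≰⇒> x≰1)

      1+y≈x : 1# + y ≈ x
      1+y≈x = trans (+-comm 1# y) (x-y+y≈x x 1#)

      y-solution : (1# + y) ^ m ≈ ρ r * y
      y-solution = begin-equality
        (1# + y) ^ m       ≈⟨ ^-congˡ m 1+y≈x ⟩
        x ^ m              ≈⟨ x/z*z≈x _ (<⇒≉0 0<y) ⟨
        (x ^ m / y) * y    ≈⟨ *-congʳ (x-y≈0⇒x≈y _ _ x-root) ⟩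
        ρ r * y            ∎

  largest-root : ∀ {r} → r* ≤ r →
    ∃[ β ] 0# < β × (1# + β) ^ m ≈ ρ r * β × IsLargestRoot r (1# + β)
  largest-root r*≤r =
    let β , 0<β , eq , largest = largest-solution m 2≤m (≤-trans 0≤ρ* (ρ*≤ρ r*≤r))
          -- The initial point is 1 / (m - 1), the minimiser less 1; `r* ≤ r` places it in the set.
          (μ ⁻¹ , <⇒≤ (⁻¹-positive 0<μ) , minimiser-bound (ρ*≤ρ r*≤r))
    in β , 0<β , eq , largest-solution⇒largest-root 0<β eq largest

  -- The scaled and rotated geometric sweep, and its cost bounds.

  module GeometricSweep {β : Carrier} (0<β : 0# < β) where

    private
      b = 1# + β

      1≤b : 1# ≤ b
      1≤b = x≤x+y 1# (<⇒≤ 0<β)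

      0<b : 0# < b
      0<b = <-≤-trans 0<1 1≤b

    sweep : ∀ {s} → 0# < s → ℕ → SearchStrategy
    sweep {s} 0<s o = record
      { length   = λ i → s * b ^ i
      ; ray      = λ i → (i ℕ.+ o) mod m
      ; positive = λ i → *-positive 0<s (^-positive i 0<b)
      }

    module _ (d₀ : Carrier) (0<d₀ : 0# < d₀) {s : Carrier} (0<s : 0# < s) (o : ℕ) where

      private
        X = sweep 0<s o
        module X = SearchStrategy X

      distance-positive : ∀ t → 0# < Position.distance {d₀} t
      distance-positive t = <-≤-trans 0<d₀ (Position.far t)

      reaches? : ∀ t → Decidable (Reaches d₀ X t)
      reaches? t i = (X.ray i Fin.≟ Position.ray t) ×-dec (Position.distance t ≤? X.length i)

      reaches-beyond : ∀ t n → Position.distance t / s ≤ b ^ n → ∃[ i ] Reaches d₀ X t i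
      reaches-beyond t n d/s≤bⁿ = i , ≡.trans (≡.cong (_mod m) i+o≡) (toℕ+km-mod u (n ℕ.+ o)) , (begin
          d            ≈⟨ x/z*z≈x d (<⇒≉0 0<s) ⟨
          (d / s) * s  ≤⟨ *-monoʳ-≤ (<⇒≤ 0<s) d/s≤bⁿ ⟩
          b ^ n * s    ≈⟨ *-comm _ s ⟩
          s * b ^ n    ≤⟨ *-monoˡ-≤ (<⇒≤ 0<s) (^-monoʳ-≤ 1≤b n≤i) ⟩
          s * b ^ i    ∎)
        where
        open Position t renaming (distance to d; ray to u)
        -- Makes `i + o` congruent to `u` modulo `m`; the multiple `n + o` ensures `n ≤ i` and that
        -- the subtraction does not truncate.
        i = (toℕ u ℕ.+ (n ℕ.+ o) ℕ.* m) ∸ o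

        n+o≤ : n ℕ.+ o ≤ℕ toℕ u ℕ.+ (n ℕ.+ o) ℕ.* m
        n+o≤ = ℕ.≤-trans (ℕ.m≤m*n (n ℕ.+ o) m) (ℕ.m≤n+m _ (toℕ u))

        i+o≡ : i ℕ.+ o ≡ toℕ u ℕ.+ (n ℕ.+ o) ℕ.* m
        i+o≡ = ℕ.m∸n+n≡m (ℕ.≤-trans (ℕ.m≤n+m o n) n+o≤)

        n≤i : n ≤ℕ i
        n≤i = ℕ.m+n≤o⇒m≤o∸n n n+o≤

      eventually-reaches : ∀ t → ∃[ i ] Reaches d₀ X t i
      eventually-reaches t =
        let n , d/s≤bⁿ = ^-unbounded 0<β (Position.distance t / s) in reaches-beyond t n d/s≤bⁿ

      first-reach : ∀ t → ∃[ i ] Reaches d₀ X t i × (∀ j → j ℕ.< i → ¬ Reaches d₀ X t j)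
      first-reach t = let n , hit = eventually-reaches t in least-witness (reaches? t) n hit

      -- β times the sum is the difference of the lengths i and 0; dropping the latter bounds the
      -- earlier iterations by the turning point of iteration i alone.
      sum-length : ∀ i → β * sum {i} (X.length ∘ toℕ) ≤ s * b ^ i
      sum-length i = begin
        β * sum {i} (X.length ∘ toℕ)              ≤⟨ x≤x+y _ (<⇒≤ (X.positive 0)) ⟩
        β * sum {i} (X.length ∘ toℕ) + X.length 0 ≈⟨ sum-geometric X.length step i ⟩
        s * b ^ i                                 ∎
        where
        step : ∀ i → s * b ^ suc i ≈ b * (s * b ^ i)
        step i = solve 3 (λ s b y → s :* (b :* y) := b :* (s :* y)) refl s b (b ^ i)

      walked-bound : ∀ t i {L} → two * sum {i} (X.length ∘ toℕ) ≤ L * Position.distance t →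
                     walked d₀ X t i / Position.distance t ≤ 1# + L
      walked-bound t i {L} le = x≤y*z⇒x/z≤y (distance-positive t) (begin
        two * sum {i} (X.length ∘ toℕ) + d ≤⟨ +-monoˡ-≤ d le ⟩
        L * d + d                          ≈⟨ solve 2 (λ L d → L :* d :+ d := (con 1 :+ L) :* d) refl L d ⟩
        (1# + L) * d                       ∎)
        where open Position t renaming (distance to d)

      -- Every target is eventually reached, which excludes `missed`. The last leg contributes the
      -- summand 1, so only the round trips before the first reach remain to be estimated.
      cost-ratio-bound : ∀ t {L δ} →
        (∀ i → Reaches d₀ X t i → (∀ j → j ℕ.< i → ¬ Reaches d₀ X t j) →
               two * sum {i} (X.length ∘ toℕ) ≤ L * Position.distance t) →
        Cost d₀ X t δ → δ /⁺ Position.distance t ≤⁺ [ 1# + L ]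
      cost-ratio-bound t bound (found i hit first) = [ walked-bound t i (bound i hit first) ]
      cost-ratio-bound t bound (missed never) =
        let i , hit = eventually-reaches t in ⊥-elim (never i hit)

      -- Iteration `k` reaches `h`, so the first reach i is at most k, and the earlier lengths sum
      -- to at most length i / β ≤ d / β.
      consistent : ∀ h {δ} k → X.ray k ≡ Position.ray h → X.length k ≈ Position.distance h →
                   Cost d₀ X h δ →
                   δ /⁺ Position.distance h ≤⁺ [ 1# + two / (b - 1#) ]
      consistent h k ray≡ length≈ = cost-ratio-bound h bound
        where
        open Position h renaming (distance to d)
        q = two / (b - 1#)

        b-1≉0 : b - 1# ≉ 0#
        b-1≉0 eq = <⇒≉0 0<β (trans (sym (1+β-1≈β β)) eq)

        0≤q : 0# ≤ q
        0≤q = <⇒≤ (/-positive 0<two (<-≤-trans 0<β (≤-reflexive (sym (1+β-1≈β β)))))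

        bound : ∀ i → Reaches d₀ X h i → (∀ j → j ℕ.< i → ¬ Reaches d₀ X h j) →
                two * sum {i} (X.length ∘ toℕ) ≤ q * d
        bound i _ first = begin
          two * S              ≈⟨ *-congʳ (x/z*z≈x two b-1≉0) ⟨
          q * (b - 1#) * S     ≈⟨ *-congʳ (*-congˡ (1+β-1≈β β)) ⟩
          q * β * S            ≈⟨ *-assoc q β S ⟩
          q * (β * S)          ≤⟨ *-monoˡ-≤ 0≤q (sum-length i) ⟩
          q * (s * b ^ i)      ≤⟨ *-monoˡ-≤ 0≤q (*-monoˡ-≤ (<⇒≤ 0<s) (^-monoʳ-≤ 1≤b i≤k)) ⟩
          q * (s * b ^ k)      ≈⟨ *-congˡ length≈ ⟩
          q * d                ∎
          where
          S = sum {i} (X.length ∘ toℕ)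
          i≤k : i ≤ℕ k
          i≤k = ℕ.≮⇒≥ λ k<i → first k k<i (ray≡ , ≤-reflexive (sym length≈))

      -- It suffices that the turning point s b^i of the first reach is at most d b^m. For i ≥ m,
      -- iteration i - m was on the same ray and fell short of the target; for i < m, s ≤ d₀ ≤ d and
      -- b^i ≤ b^m. Then b^m = ρ β lets β cancel.
      robust : s ≤ d₀ → ∀ {ρ} → b ^ m ≈ ρ * β → ∀ t {δ} → Cost d₀ X t δ →
               δ /⁺ Position.distance t ≤⁺ [ 1# + two * ρ ]
      robust s≤d₀ {ρ} bᵐ≈ρβ t = cost-ratio-bound t bound
        where
        open Position t renaming (distance to d)

        length≤bᵐd : ∀ i → Reaches d₀ X t i → (∀ j → j ℕ.< i → ¬ Reaches d₀ X t j) →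
                     s * b ^ i ≤ d * b ^ m
        length≤bᵐd i hit first with i ℕ.<? m
        ... | yes i<m = *-mono-≤ (<⇒≤ 0<s) (^-nonNegative m (<⇒≤ 0<b))
                          (≤-trans s≤d₀ (Position.far t)) (^-monoʳ-≤ 1≤b (ℕ.<⇒≤ i<m))
        ... | no  i≮m = begin
          s * b ^ i               ≡⟨ ≡.cong (λ k → s * b ^ k) j+m≡i ⟨
          s * b ^ (j ℕ.+ m)       ≈⟨ *-congˡ (^-homo-* b j m) ⟩
          s * (b ^ j * b ^ m)     ≈⟨ *-assoc s _ _ ⟨
          (s * b ^ j) * b ^ m     ≤⟨ *-monoʳ-≤ (^-nonNegative m (<⇒≤ 0<b)) length-j≤d ⟩
          d * b ^ m               ∎
          where
          j = i ∸ m
          j+m≡i = ℕ.m∸n+n≡m (ℕ.≮⇒≥ i≮m)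

          -- The factor 1 matches the form of `[m+kn]%n≡m%n`.
          j+o+m≡i+o : j ℕ.+ o ℕ.+ 1 ℕ.* m ≡ i ℕ.+ o
          j+o+m≡i+o = ≡.trans (ℕ.+-assoc j o (1 ℕ.* m))
            (≡.trans (≡.cong (j ℕ.+_) (≡.trans (≡.cong (o ℕ.+_) (ℕ.*-identityˡ m)) (ℕ.+-comm o m)))
            (≡.trans (≡.sym (ℕ.+-assoc j m o)) (≡.cong (ℕ._+ o) j+m≡i)))

          ray-j : X.ray j ≡ Position.ray t
          ray-j = ≡.trans (mod-cong m (≡.trans (≡.sym ([m+kn]%n≡m%n (j ℕ.+ o) 1 m))
                                               (≡.cong (_% m) j+o+m≡i+o)))
                          (proj₁ hit)

          j<i : j ℕ.< i
          j<i = ≡.subst (j ℕ.<_) j+m≡i (ℕ.m<m+n j (ℕ.>-nonZero⁻¹ m))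

          length-j≤d : s * b ^ j ≤ d
          length-j≤d = <⇒≤ (≰⇒> λ d≤ → first j j<i (ray-j , d≤))

        bound : ∀ i → Reaches d₀ X t i → (∀ j → j ℕ.< i → ¬ Reaches d₀ X t j) →
                two * sum {i} (X.length ∘ toℕ) ≤ two * ρ * d
        bound i hit first = ≤-respʳ-≈ (sym (*-assoc two ρ d)) (*-monoˡ-≤ (<⇒≤ 0<two)
          (*-cancelʳ-≤ 0<β (begin
            S * β         ≈⟨ *-comm S β ⟩
            β * S         ≤⟨ sum-length i ⟩
            s * b ^ i     ≤⟨ length≤bᵐd i hit first ⟩
            d * b ^ m     ≈⟨ *-congˡ bᵐ≈ρβ ⟩
            d * (ρ * β)   ≈⟨ solve 3 (λ d ρ β → d :* (ρ :* β) := ρ :* d :* β) refl d ρ β ⟩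
            ρ * d * β     ∎)))
          where S = sum {i} (X.length ∘ toℕ)

  -- Fitting the sweep to a prediction.

  module PredictedSweep (d₀ : Carrier) (0<d₀ : 0# < d₀) {β : Carrier} (0<β : 0# < β) where
    open GeometricSweep 0<β

    module Parameters (h : Position d₀) where
      open Position h

      private
        -- An exponent with d_h / d₀ ≤ b^k, which is what `scale≤d₀` rests on.
        unbounded = ^-unbounded 0<β (distance / d₀)

      index : ℕ
      index = proj₁ unbounded

      private
        0<bᵏ = ^-positive index (+-positiveˡ 0<1 (<⇒≤ 0<β))

      scale : Carrier
      scale = distance / (1# + β) ^ index

      scale-positive : 0# < scale
      -- `0<1` and `0` are arbitrary values for the scale and offset of the enclosing module.
      scale-positive = /-positive (distance-positive d₀ 0<d₀ 0<1 0 h) 0<bᵏ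

      scale≤d₀ : scale ≤ d₀
      scale≤d₀ = x≤y*z⇒x/z≤y 0<bᵏ (begin
        distance                       ≈⟨ x/z*z≈x distance (<⇒≉0 0<d₀) ⟨
        (distance / d₀) * d₀           ≤⟨ *-monoʳ-≤ (<⇒≤ 0<d₀) (proj₂ unbounded) ⟩
        (1# + β) ^ index * d₀          ≈⟨ *-comm _ d₀ ⟩
        d₀ * (1# + β) ^ index          ∎)

      length-index : scale * (1# + β) ^ index ≈ distance
      length-index = x/z*z≈x distance (<⇒≉0 0<bᵏ)

      offset : ℕ
      -- Chosen so that `index + offset` is `ray` plus a multiple of `m`, a multiple large enough to
      -- keep the subtraction exact.
      offset = (toℕ ray ℕ.+ index ℕ.* m) ∸ index

      ray-index : (index ℕ.+ offset) mod m ≡ ray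
      ray-index = ≡.trans (≡.cong (_mod m) (ℕ.m+[n∸m]≡n index≤)) (toℕ+km-mod ray index)
        where
        index≤ : index ≤ℕ toℕ ray ℕ.+ index ℕ.* m
        index≤ = ℕ.≤-trans (ℕ.m≤m*n index m) (ℕ.m≤n+m _ (toℕ ray))

    strategy : PredictionStrategy d₀
    strategy h = sweep scale-positive offset
      where open Parameters h

    private
      -- A sample position whose finite cost supplies the real member that `supremum⁺` requires of
      -- both ratio sets.
      h₀ : Position d₀
      h₀ = record { distance = d₀ ; ray = 0 mod m ; far = ≤-refl }

      cost₀ : ∃[ δ ] Cost d₀ (strategy h₀) h₀ [ δ ]
      cost₀ = let i , hit , first = first-reach d₀ 0<d₀ scale-positive offset h₀
              in _ , found i hit first
        where open Parameters h₀

    strategy-robust : ∀ r → (1# + β) ^ m ≈ ρ r * β → Robust d₀ r strategy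
    strategy-robust r bᵐ≈ρβ = supremum⁺ (RobustnessRatio d₀ strategy)
      (_ , ratio h₀ h₀ (proj₂ cost₀)) r bound
      where
      bound : ∀ x → RobustnessRatio d₀ strategy x → x ≤⁺ [ r ]
      bound _ (ratio h t cost) = ≤⁺-trans _≤_ ≤-trans
        (robust d₀ 0<d₀ scale-positive offset scale≤d₀ bᵐ≈ρβ t cost)
        [ ≤-reflexive (sym (r≈1+2ρ r)) ]
        where open Parameters h

    strategy-consistent : ConsistencyAtMost d₀ strategy (1# + two / ((1# + β) - 1#))
    strategy-consistent = supremum⁺ (ConsistencyRatio d₀ strategy)
      (_ , ratio h₀ (proj₂ cost₀)) _ bound
      where
      bound : ∀ x → ConsistencyRatio d₀ strategy x → x ≤⁺ [ 1# + two / ((1# + β) - 1#) ]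
      bound _ (ratio h cost) =
        consistent d₀ 0<d₀ scale-positive offset h index ray-index length-index cost
        where open Parameters h

theorem10 : ∀ {c ℓ₁ ℓ₂} (ℝ : RealField c ℓ₁ ℓ₂) (m : ℕ) → 2 ≤ℕ m →
    let open RealField ℝ
        open StarSearch ℝ m
    in
    (d₀ : Carrier) → 0# < d₀ →
    (r : Carrier) → r* ≤ r →
    ∃[ b ] IsLargestRoot r b ×
      (∃[ S ] Robust d₀ r S ×
              ConsistencyAtMost d₀ S (1# + fromℕ 2 / (b - 1#)))
theorem10 ℝ m 2≤m d₀ 0<d₀ r r*≤r =
  let β , 0<β , eq , largest = largest-root r*≤r
      open PredictedSweep d₀ 0<d₀ 0<β
  -- The root left implicit is b = 1 + β.
  in _ , largest , strategy , strategy-robust r eq , strategy-consistent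
  where open StarSearchProperties ℝ m 2≤m
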